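{- For $\mu$-almost every $A\in 2^\omega$, the many-one degree $\deg_m(A)$ contains an infinite antichain of $1$-degrees, i.e. there is an infinite sequence $(B_i)_{i\in\omega}$ of subsets of $\omega$ with $B_i\equiv_m A$ for every $i$ and $B_i\not\le_1 B_j$ for all $i\neq j$. In particular, every Martin-Löf random set $A$ has this property.
   Context: $\omega=\{0,1,2,\dots\}$; sets $A\subseteq\omega$ are identified with their characteristic functions in Cantor space $2^\omega$. For a finite binary string $\sigma$, $[\sigma]=\{X\in 2^\omega:\sigma \text{ is an initial segment of } X\}$, and $\mu$ is the fair-coin product measure on $2^\omega$, determined by $\mu([\sigma])=2^{ -|\sigma|}$. For $A,B\subseteq\omega$: $A\le_m B$ if there is a total computable function $f:\omega\to\omega$ such that for all $x$, $x\in A\iff f(x)\in B$; $A\le_1 B$ if there is such an $f$ which is moreover injective. $A\equiv_m B$ means $A\le_m B$ and $B\le_m A$; $A\equiv_1 B$ means $A\le_1 B$ and $B\le_1 A$. $\deg_m(A)=\{X\subseteq\omega: X\equiv_m A\}$ and $\deg_1(A)=\{X\subseteq\omega: X\equiv_1 A\}$. A Martin-Löf test is a sequence $(U_n)_{n\in\omega}$ of uniformly c.e. open subsets of $2^\omega$ (i.e. $U_n=\bigcup_{\sigma\in W_n}[\sigma]$ for a uniformly computably enumerable sequence $(W_n)_{n\in\omega}$ of sets of finite binary strings) such that $\mu(U_n)\le 2^{ -n}$ for all $n$. A set $X\in 2^\omega$ is Martin-Löf random if $X\notin\bigcap_n U_n$ for every Martin-Löf test $(U_n)_{n\in\omega}$.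 -}

module Defs where

open import Data.Bool.Base using (Bool; true; false; T)
open import Data.Fin.Base using (Fin)
open import Data.List.Base using (List; []; _∷_; length; map; foldr; applyUpTo)
open import Data.List.Relation.Unary.All using (All)
open import Data.List.Relation.Unary.AllPairs using (AllPairs)
open import Data.Nat.Base using (ℕ; zero; suc; _<_)
import Data.Nat.Base as ℕ
open import Data.Product.Base using (Σ; ∃-syntax; _×_)
open import Data.Rational.Base using (ℚ; 0ℚ; 1ℚ; ½; _+_; _*_; _≤_)
open import Data.Vec.Base as Vec using (Vec; []; _∷_)
open import Data.Vec.Relation.Binary.Pointwise.Inductive using (Pointwise)
open import Function.Bundles using (_⇔_)
open import Function.Definitions using (Injective)
open import Level using (0ℓ)
open import Relation.Binary.PropositionalEquality using (_≡_; _≢_)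
open import Relation.Nullary.Negation using (¬_)
open import Relation.Unary using (Pred; _∈_; _∉_; _⊆_; _⊥_)

-- Codes for Kleene's partial recursive functions.
data Rec : ℕ → Set where
  zer  : Rec 0
  succ : Rec 1
  proj : ∀ {n} → Fin n → Rec n
  comp : ∀ {m n} → Rec m → Vec (Rec n) m → Rec n
  prec : ∀ {n} → Rec n → Rec (suc (suc n)) → Rec (suc n)
  mu   : ∀ {n} → Rec (suc n) → Rec n

infix 4 _[_]⇓_

-- e [ xs ]⇓ y : the partial function e is defined at xs, with value y.
-- The recursion variable of prec and the search variable of mu come
-- first; the step function of prec takes the predecessor, the previous
-- value and the parameters, in this order.
data _[_]⇓_ : ∀ {n} → Rec n → Vec ℕ n → ℕ → Set where
  zer⇓      : zer [ [] ]⇓ 0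
  succ⇓     : ∀ {x} → succ [ x ∷ [] ]⇓ suc x
  proj⇓     : ∀ {n} {i : Fin n} {xs} → proj i [ xs ]⇓ Vec.lookup xs i
  comp⇓     : ∀ {m n} {f : Rec m} {gs : Vec (Rec n) m} {xs ys z} →
              Pointwise (λ g y → g [ xs ]⇓ y) gs ys →
              f [ ys ]⇓ z → comp f gs [ xs ]⇓ z
  prec-zero : ∀ {n} {f : Rec n} {g xs y} →
              f [ xs ]⇓ y → prec f g [ 0 ∷ xs ]⇓ y
  prec-suc  : ∀ {n} {f : Rec n} {g xs k y z} →
              prec f g [ k ∷ xs ]⇓ y → g [ k ∷ y ∷ xs ]⇓ z →
              prec f g [ suc k ∷ xs ]⇓ z
  mu⇓       : ∀ {n} {f : Rec (suc n)} {xs y} →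
              f [ y ∷ xs ]⇓ 0 →
              (∀ {z} → z < y → ∃[ v ] f [ z ∷ xs ]⇓ suc v) →
              mu f [ xs ]⇓ y

Halts : ∀ {n} → Rec n → Vec ℕ n → Set
Halts e xs = ∃[ y ] e [ xs ]⇓ y

Computable : (ℕ → ℕ) → Set
Computable f = Σ (Rec 1) λ e → ∀ x → e [ x ∷ [] ]⇓ f x

Cantor : Set
Cantor = ℕ → Bool

Str : Set
Str = List Bool

[_] : Str → Pred Cantor 0ℓ
[ σ ] X = applyUpTo X (length σ) ≡ σ

⟦_⟧ : Pred Str 0ℓ → Pred Cantor 0ℓ
⟦ W ⟧ X = ∃[ σ ] σ ∈ W × X ∈ [ σ ]

2⁻^ : ℕ → ℚ
2⁻^ zero    = 1ℚ
2⁻^ (suc n) = ½ * 2⁻^ n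

-- Σ 2^(-|σ|), the measure of the union of the listed cylinders when they
-- are pairwise disjoint.
weight : List Str → ℚ
weight σs = foldr _+_ 0ℚ (map (λ σ → 2⁻^ (length σ)) σs)

-- μ⟦ W ⟧≤ q says that the open set ⟦ W ⟧ has measure at most q.
-- The prefix-minimal strings of W are pairwise incompatible and generate
-- the same open set, so by countable additivity μ ⟦ W ⟧ is the supremum
-- of the total measures of finite families of pairwise disjoint
-- cylinders [ σ ] with σ ∈ W. W itself need not be prefix-free.
μ⟦_⟧≤_ : Pred Str 0ℓ → ℚ → Set
μ⟦ W ⟧≤ q = ∀ σs → All W σs → AllPairs (λ σ τ → [ σ ] ⊥ [ τ ]) σs →
            weight σs ≤ q

-- Null sets: those covered by open sets of arbitrarily small measure.
Null : Pred Cantor 0ℓ → Set₁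
Null N = ∀ n → Σ (Pred Str 0ℓ) λ W → N ⊆ ⟦ W ⟧ × μ⟦ W ⟧≤ 2⁻^ n

AlmostEvery : Pred Cantor 0ℓ → Set₁
AlmostEvery P = Σ (Pred Cantor 0ℓ) λ N → Null N × (∀ A → A ∉ N → A ∈ P)

-- The bijection between strings and natural numbers given by bijective
-- base-2 notation, least significant digit first.
code : Str → ℕ
code []          = 0
code (false ∷ σ) = 1 ℕ.+ 2 ℕ.* code σ
code (true  ∷ σ) = 2 ℕ.+ 2 ℕ.* code σ

-- The set of pairs (n , σ) with σ ∈ W n is the domain of a partial
-- recursive function.
UniformlyCE : (ℕ → Pred Str 0ℓ) → Set
UniformlyCE W = Σ (Rec 2) λ e →
  ∀ n σ → σ ∈ W n ⇔ Halts e (n ∷ code σ ∷ [])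

record MLTest : Set₁ where
  field
    W     : ℕ → Pred Str 0ℓ
    ce    : UniformlyCE W
    small : ∀ n → μ⟦ W n ⟧≤ 2⁻^ n

MLRandom : Cantor → Set₁
MLRandom X = ∀ (U : MLTest) → ¬ (∀ n → X ∈ ⟦ MLTest.W U n ⟧)

infix 4 _≤ₘ_ _≤₁_ _≡ₘ_

Reduces : (ℕ → ℕ) → Cantor → Cantor → Set
Reduces f A B = ∀ x → T (A x) ⇔ T (B (f x))

_≤ₘ_ : Cantor → Cantor → Set
A ≤ₘ B = ∃[ f ] Computable f × Reduces f A B

_≤₁_ : Cantor → Cantor → Set
A ≤₁ B = ∃[ f ] Computable f × Injective _≡_ _≡_ f × Reduces f A B

_≡ₘ_ : Cantor → Cantor → Set
A ≡ₘ B = A ≤ₘ B × B ≤ₘ A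

degₘ : Cantor → Pred Cantor 0ℓ
degₘ A X = X ≡ₘ A

-- A sequence in degₘ A whose terms are pairwise incomparable under ≤₁;
-- as i and j range over all ordered pairs, both directions are excluded.
HasInfiniteAntichain : Pred Cantor 0ℓ
HasInfiniteAntichain A =
  Σ (ℕ → Cantor) λ B →
    (∀ i → B i ∈ degₘ A) × (∀ i j → i ≢ j → ¬ (B i ≤₁ B j))

{-# OPTIONS --safe #-}

-- Column i is a computable infinite set of numbers, distinct columns being
-- disjoint, and cover i is a computable surjection whose fibres have two
-- elements over column i and one element elsewhere. All A ∘ cover i lie in
-- the many-one degree of A. An injective reduction f from A ∘ cover i to
-- A ∘ cover j with i ≢ j cannot map all two-element fibres over column i
-- into the one-element fibres of cover j over the same numbers, so it gives
-- computable q n ≢ w n with A (q n) = A (w n) for all n and q unbounded.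
-- Infinitely many of these coincidences are independent, and a Martin-Löf
-- random set does not satisfy them all. The measure bound is Ville's
-- inequality, applied to the conditional probability of the coincidences
-- as a martingale. Finally, almost every set is random, as there are only
-- countably many Martin-Löf tests.
module Submission where

open import Defs
open import Data.Bool.Base using (Bool; true; false; T; if_then_else_)
import Data.Empty as Empty
open import Data.Fin.Base using (Fin; zero; suc; toℕ)
open import Data.Fin.Properties using (toℕ-injective)
open import Data.List.Base using (List; []; _∷_; _∷ʳ_; length; applyUpTo)
open import Data.List.Properties using (length-applyUpTo)
open import Data.List.Relation.Binary.Sublist.Propositional using ([]; _∷_) renaming (_⊆_ to _⊑_; _∷ʳ_ to skip)
open import Data.List.Relation.Binary.Sublist.Propositional.Properties using (All-resp-⊆)
open import Data.List.Relation.Unary.All as All using (All; []; _∷_)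
open import Data.List.Relation.Unary.AllPairs using (AllPairs; []; _∷_)
open import Data.Nat.Base using (ℕ; zero; suc; z≤n; s≤s; _<_; _⊔_; _⊓_; _∸_; _≡ᵇ_; pred; ⌊_/2⌋; ⌈_/2⌉)
import Data.Nat.Base as ℕ
import Data.Nat.Properties as ℕ
open import Data.Product.Base using (Σ; ∃-syntax; _×_; _,_; proj₁; proj₂)
open import Data.Rational.Base using (ℚ; 0ℚ; 1ℚ; ½; _+_; _*_; _≤_; NonNegative)
open import Data.Rational.Properties
  using (≤-reflexive; +-assoc; +-identityˡ; +-identityʳ; +-mono-≤; +-monoˡ-≤; +-monoʳ-≤; *-zeroʳ; *-identityˡ;
         *-distribʳ-+; *-monoˡ-≤-nonNeg; nonNegative⁻¹; module ≤-Reasoning)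
open import Data.Rational.Solver using (module +-*-Solver)
open import Data.Sum.Base using (_⊎_; inj₁; inj₂)
open import Data.Unit.Base using (tt)
open import Data.Vec.Base using (Vec; []; _∷_; lookup)
open import Data.Vec.Relation.Binary.Pointwise.Inductive using (Pointwise; []; _∷_)
open import Function.Base using (_∘_)
open import Function.Bundles using (_⇔_; mk⇔; Equivalence)
open import Function.Definitions using (Injective)
open import Function.Properties.Equivalence using () renaming (refl to ⇔-refl)
open import Level using (0ℓ)
open import Relation.Binary.Definitions using (tri<; tri≈; tri>)
open import Relation.Binary.PropositionalEquality
  using (_≡_; _≢_; refl; sym; trans; cong; cong₂; subst; subst₂; module ≡-Reasoning)
open import Relation.Nullary using (¬_; contradiction)
open import Relation.Unary using (Pred; _⊥_; _∈_; _⊆_)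

open +-*-Solver using (solve; _:=_; _:+_; _:*_; con)

-- Weights of finite families of disjoint cylinders

Disjoint : Str → Str → Set
Disjoint σ τ = [ σ ] ⊥ [ τ ]

prepend : Bool → Cantor → Cantor
prepend b X zero    = b
prepend b X (suc x) = X x

-- Disjointness speaks of infinite sequences; a point in every cylinder turns it into
-- incompatibility of strings.
[]-inhabited : ∀ σ → ∃[ X ] X ∈ [ σ ]
[]-inhabited []      = (λ _ → false) , refl
[]-inhabited (b ∷ σ) with X , X∈σ ← []-inhabited σ = prepend b X , cong (b ∷_) X∈σ

Disjoint-∷⁻ : ∀ b {σ τ} → Disjoint (b ∷ σ) (b ∷ τ) → Disjoint σ τ
Disjoint-∷⁻ b d (X∈σ , X∈τ) = d {prepend b _} (cong (b ∷_) X∈σ , cong (b ∷_) X∈τ)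

-- Conditioning on the first digit: each half of Cantor space is rescaled to the whole space. The
-- empty string is dropped here and treated by `antichain-cases`.
tails : Bool → List Str → List Str
tails b     []                  = []
tails b     ([] ∷ σs)           = tails b σs
tails false ((false ∷ σ) ∷ σs) = σ ∷ tails false σs
tails false ((true  ∷ σ) ∷ σs) = tails false σs
tails true  ((false ∷ σ) ∷ σs) = tails true σs
tails true  ((true  ∷ σ) ∷ σs) = σ ∷ tails true σs

All-tails : ∀ {P : Pred Str 0ℓ} b {σs} → All P σs → All (P ∘ (b ∷_)) (tails b σs)
All-tails b     []                            = []
All-tails b     {[] ∷ _}          (_ ∷ ps)    = All-tails b ps
All-tails false {(false ∷ _) ∷ _} (p ∷ ps) = p ∷ All-tails false ps
All-tails false {(true  ∷ _) ∷ _} (_ ∷ ps) = All-tails false ps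
All-tails true  {(false ∷ _) ∷ _} (_ ∷ ps) = All-tails true ps
All-tails true  {(true  ∷ _) ∷ _} (p ∷ ps) = p ∷ All-tails true ps

AllPairs-tails : ∀ b {σs} → AllPairs Disjoint σs → AllPairs Disjoint (tails b σs)
AllPairs-tails b     []                           = []
AllPairs-tails b     {[] ∷ _}          (_ ∷ ds)   = AllPairs-tails b ds
AllPairs-tails false {(false ∷ _) ∷ _} (d ∷ ds)   =
  All.map (Disjoint-∷⁻ false) (All-tails false d) ∷ AllPairs-tails false ds
AllPairs-tails false {(true  ∷ _) ∷ _} (_ ∷ ds)   = AllPairs-tails false ds
AllPairs-tails true  {(false ∷ _) ∷ _} (_ ∷ ds)   = AllPairs-tails true ds
AllPairs-tails true  {(true  ∷ _) ∷ _} (d ∷ ds)   =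
  All.map (Disjoint-∷⁻ true) (All-tails true d) ∷ AllPairs-tails true ds

NonEmpty : Str → Set
NonEmpty σ = 0 < length σ

weight-tails : ∀ {σs} → All NonEmpty σs →
               weight σs ≡ ½ * (weight (tails false σs) + weight (tails true σs))
weight-tails [] = refl
weight-tails {(false ∷ σ) ∷ σs} (_ ∷ ps) = trans (cong (½ * 2⁻^ (length σ) +_) (weight-tails ps))
  (solve 3 (λ x y z → con ½ :* x :+ con ½ :* (y :+ z) := con ½ :* ((x :+ y) :+ z)) refl
    (2⁻^ (length σ)) (weight (tails false σs)) (weight (tails true σs)))
weight-tails {(true ∷ σ) ∷ σs} (_ ∷ ps) = trans (cong (½ * 2⁻^ (length σ) +_) (weight-tails ps))
  (solve 3 (λ x y z → con ½ :* x :+ con ½ :* (y :+ z) := con ½ :* (y :+ (x :+ z))) refl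
    (2⁻^ (length σ)) (weight (tails false σs)) (weight (tails true σs)))

-- The cylinder of the empty string is the whole space, so it is disjoint from no other cylinder.
antichain-cases : ∀ {σs} → AllPairs Disjoint σs → All NonEmpty σs ⊎ σs ≡ [] ∷ []
antichain-cases [] = inj₁ []
antichain-cases {[] ∷ []} _ = inj₂ refl
antichain-cases {[] ∷ τ ∷ _} ((d ∷ _) ∷ _) =
  contradiction (refl , proj₂ ([]-inhabited τ)) (d {proj₁ ([]-inhabited τ)})
antichain-cases {(b ∷ σ) ∷ σs} (ds ∷ dss) with antichain-cases dss
... | inj₁ ps = inj₁ (s≤s z≤n ∷ ps)
... | inj₂ refl with d ∷ [] ← ds = contradiction (proj₂ ([]-inhabited (b ∷ σ)) , refl) (d {proj₁ ([]-inhabited (b ∷ σ))})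

All-bounded : ∀ {P : ℕ → Pred Str 0ℓ} {σs} → All (λ σ → ∃[ c ] P c σ) σs →
              ∃[ K ] All (λ σ → ∃[ c ] c < K × P c σ) σs
All-bounded [] = 0 , []
All-bounded ((c , p) ∷ ps) with K , qs ← All-bounded ps =
  suc c ⊔ K , (c , ℕ.m≤m⊔n (suc c) K , p) ∷
    All.map (λ (c′ , lt , q) → c′ , ℕ.≤-trans lt (ℕ.m≤n⊔m (suc c) K) , q) qs

-- Ville's inequality

Martingale : (Str → ℚ) → Set
Martingale v = ∀ σ → ½ * (v (σ ∷ʳ false) + v (σ ∷ʳ true)) ≡ v σ

½*-mono : ∀ {p q} → p ≤ q → ½ * p ≤ ½ * q
½*-mono = *-monoˡ-≤-nonNeg ½

-- Induction on the length bound: unless the family is just the empty string, condition on the first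
-- digit. Each `v ∘ (b ∷_)` is again a martingale, and fairness at the root averages the two bounds.
ville-bounded : ∀ L v → (∀ σ → 0ℚ ≤ v σ) → Martingale v →
  ∀ {σs} → All (λ σ → length σ < L) σs → All (λ σ → 1ℚ ≤ v σ) σs →
  AllPairs Disjoint σs → weight σs ≤ v []
ville-bounded zero    v v≥0 fair [] vs ds = v≥0 []
ville-bounded (suc L) v v≥0 fair {σs} ls vs ds with antichain-cases ds
... | inj₂ refl with 1≤v ∷ [] ← vs = 1≤v
... | inj₁ ps = begin
  weight σs                                             ≡⟨ weight-tails ps ⟩
  ½ * (weight (tails false σs) + weight (tails true σs)) ≤⟨ ½*-mono (+-mono-≤ (below false) (below true)) ⟩
  ½ * (v (false ∷ []) + v (true ∷ []))                  ≡⟨ fair [] ⟩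
  v []                                                  ∎
  where
  open ≤-Reasoning
  below : ∀ b → weight (tails b σs) ≤ v (b ∷ [])
  below b = ville-bounded L (v ∘ (b ∷_)) (v≥0 ∘ (b ∷_)) (fair ∘ (b ∷_))
    (All.map ℕ.s≤s⁻¹ (All-tails b ls)) (All-tails b vs) (AllPairs-tails b ds)

ville : ∀ {W : Pred Str 0ℓ} v → (∀ σ → 0ℚ ≤ v σ) → Martingale v →
        (∀ {σ} → W σ → 1ℚ ≤ v σ) → μ⟦ W ⟧≤ v []
ville v v≥0 fair W⇒1≤v σs ws ds
  with L , ls ← All-bounded {P = λ c σ → length σ ≡ c} (All.tabulate (λ {σ} _ → length σ , refl)) =
  ville-bounded L v v≥0 fair (All.map (λ { (_ , lt , refl) → lt }) ls) (All.map W⇒1≤v ws) ds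

-- Countable unions of open sets

split : ∀ {P Q : Pred Str 0ℓ} {σs} → All (λ σ → P σ ⊎ Q σ) σs →
        ∃[ τs ] ∃[ ρs ] τs ⊑ σs × ρs ⊑ σs × All P τs × All Q ρs ×
        weight σs ≡ weight τs + weight ρs
split [] = [] , [] , [] , [] , [] , [] , refl
split {σs = σ ∷ _} (inj₁ p ∷ rs) with τs , ρs , τ⊑ , ρ⊑ , ps , qs , eq ← split rs =
  σ ∷ τs , ρs , refl ∷ τ⊑ , skip σ ρ⊑ , p ∷ ps , qs ,
  trans (cong (2⁻^ (length σ) +_) eq) (sym (+-assoc (2⁻^ (length σ)) (weight τs) (weight ρs)))
split {σs = σ ∷ _} (inj₂ q ∷ rs) with τs , ρs , τ⊑ , ρ⊑ , ps , qs , eq ← split rs =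
  τs , σ ∷ ρs , skip σ τ⊑ , refl ∷ ρ⊑ , ps , q ∷ qs ,
  trans (cong (2⁻^ (length σ) +_) eq)
    (solve 3 (λ x y z → x :+ (y :+ z) := y :+ (x :+ z)) refl (2⁻^ (length σ)) (weight τs) (weight ρs))

AllPairs-resp-⊑ : ∀ {R : Str → Str → Set} {τs σs} → τs ⊑ σs → AllPairs R σs → AllPairs R τs
AllPairs-resp-⊑ []         []         = []
AllPairs-resp-⊑ (skip _ s) (_ ∷ rs)   = AllPairs-resp-⊑ s rs
AllPairs-resp-⊑ (refl ∷ s) (r ∷ rs)   = All-resp-⊆ s r ∷ AllPairs-resp-⊑ s rs

2⁻^-halves : ∀ n → 2⁻^ (suc n) + 2⁻^ (suc n) ≡ 2⁻^ n
2⁻^-halves n = solve 1 (λ x → con ½ :* x :+ con ½ :* x := x) refl (2⁻^ n)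

2⁻^-nonNeg : ∀ n → 0ℚ ≤ 2⁻^ n
2⁻^-nonNeg zero    = nonNegative⁻¹ 1ℚ
2⁻^-nonNeg (suc n) = ½*-mono (2⁻^-nonNeg n)

module _ {V : ℕ → Pred Str 0ℓ} (n : ℕ) (small : ∀ c → μ⟦ V c ⟧≤ 2⁻^ (suc (c ℕ.+ n))) where

  split-last : ∀ {K σ} → ∃[ c ] c < suc K × V c σ → V K σ ⊎ (∃[ c ] c < K × V c σ)
  split-last (c , c≤K , w) with ℕ.m<1+n⇒m<n∨m≡n c≤K
  ... | inj₁ c<K  = inj₂ (c , c<K , w)
  ... | inj₂ refl = inj₁ w

  -- The term `2⁻^ (K ℕ.+ n)` is the part of the geometric series not yet spent; carrying it on the
  -- left makes the induction telescope.
  finite-union : ∀ K {σs} → All (λ σ → ∃[ c ] c < K × V c σ) σs → AllPairs Disjoint σs →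
                 weight σs + 2⁻^ (K ℕ.+ n) ≤ 2⁻^ n
  finite-union zero    []  _  = ≤-reflexive (+-identityˡ (2⁻^ n))
  finite-union (suc K) {σs} ws ds
    with τs , ρs , τ⊑ , ρ⊑ , last , earlier , eq ← split (All.map split-last ws)
    = begin
    weight σs + ε                  ≡⟨ cong (_+ ε) eq ⟩
    weight τs + weight ρs + ε     ≤⟨ +-monoˡ-≤ ε (+-monoˡ-≤ (weight ρs)
                                       (small K τs last (AllPairs-resp-⊑ τ⊑ ds))) ⟩
    ε + weight ρs + ε             ≡⟨ solve 2 (λ x y → x :+ y :+ x := y :+ (x :+ x)) refl ε (weight ρs) ⟩
    weight ρs + (ε + ε)           ≡⟨ cong (weight ρs +_) (2⁻^-halves (K ℕ.+ n)) ⟩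
    weight ρs + 2⁻^ (K ℕ.+ n)     ≤⟨ finite-union K earlier (AllPairs-resp-⊑ ρ⊑ ds) ⟩
    2⁻^ n                         ∎
    where
    open ≤-Reasoning
    ε = 2⁻^ (suc (K ℕ.+ n))

  -- A finite family meets only finitely many of the indices.
  countable-union : μ⟦ (λ σ → ∃[ c ] V c σ) ⟧≤ 2⁻^ n
  countable-union σs ws ds with K , ws′ ← All-bounded ws = begin
    weight σs                     ≡⟨ +-identityʳ (weight σs) ⟨
    weight σs + 0ℚ                ≤⟨ +-monoʳ-≤ (weight σs) (2⁻^-nonNeg (K ℕ.+ n)) ⟩
    weight σs + 2⁻^ (K ℕ.+ n)     ≤⟨ finite-union K ws′ ds ⟩
    2⁻^ n                         ∎
    where open ≤-Reasoning

-- The martingale of a sequence of independent coincidences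

-- at σ x is the bijective base-2 digit (1 or 2) of code σ at position x,
-- and 0 beyond the end of σ.
bit : Bool → ℕ
bit false = 1
bit true  = 2

at : Str → ℕ → ℕ
at []      x       = 0
at (b ∷ σ) zero    = bit b
at (b ∷ σ) (suc x) = at σ x

at-beyond : ∀ σ {x} → length σ ℕ.≤ x → at σ x ≡ 0
at-beyond []      _        = refl
at-beyond (b ∷ σ) (s≤s le) = at-beyond σ le

at-within : ∀ σ {x} → x < length σ → ∃[ b ] at σ x ≡ bit b
at-within (b ∷ σ) {zero}  _        = b , refl
at-within (b ∷ σ) {suc x} (s≤s lt) = at-within σ lt

at-∷ʳ-< : ∀ σ b {x} → x < length σ → at (σ ∷ʳ b) x ≡ at σ x
at-∷ʳ-< (_ ∷ σ) b {zero}  _        = refl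
at-∷ʳ-< (_ ∷ σ) b {suc x} (s≤s lt) = at-∷ʳ-< σ b lt

at-∷ʳ-length : ∀ σ b → at (σ ∷ʳ b) (length σ) ≡ bit b
at-∷ʳ-length []      b = refl
at-∷ʳ-length (_ ∷ σ) b = at-∷ʳ-length σ b

at-∷ʳ-> : ∀ σ b {x} → length σ < x → at (σ ∷ʳ b) x ≡ 0
at-∷ʳ-> []      b (s≤s _)  = refl
at-∷ʳ-> (_ ∷ σ) b (s≤s lt) = at-∷ʳ-> σ b lt

-- The conditional probability that the digits x and y agree, where y is
-- read before x, and x = 0 means that x has not been read yet.
agree : ℕ → ℕ → ℚ
agree zero    y = ½
agree (suc x) y = if suc x ≡ᵇ y then 1ℚ else 0ℚ

agree-nonNeg : ∀ x y → NonNegative (agree x y)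
agree-nonNeg zero    y = _
agree-nonNeg (suc x) y with suc x ≡ᵇ y
... | true  = _
... | false = _

agree-refl : ∀ x → x ≢ 0 → agree x x ≡ 1ℚ
agree-refl zero          x≢0 = contradiction refl x≢0
agree-refl (suc zero)    x≢0 = refl
agree-refl (suc (suc x)) x≢0 = agree-refl (suc x) λ ()

agree-total : ∀ b → agree (bit false) (bit b) + agree (bit true) (bit b) ≡ 1ℚ
agree-total false = refl
agree-total true  = refl

-- By these hypotheses, when position `c k` is read, its partner `d k` and all earlier pairs have
-- already been read.
module _ {c d : ℕ → ℕ} (d<c : ∀ k → d k < c k) (c-mono : ∀ k → c k < c (suc k)) where

  -- v n σ is the conditional probability, given that X extends σ, that
  -- X (c k) = X (d k) for all k < n.
  v : ℕ → Str → ℚ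
  v zero    σ = 1ℚ
  v (suc n) σ = agree (at σ (c n)) (at σ (d n)) * v n σ

  v-nonNeg : ∀ n σ → 0ℚ ≤ v n σ
  v-nonNeg zero    σ = nonNegative⁻¹ 1ℚ
  v-nonNeg (suc n) σ = begin
    0ℚ       ≡⟨ *-zeroʳ a ⟨
    a * 0ℚ   ≤⟨ *-monoˡ-≤-nonNeg a {{agree-nonNeg (at σ (c n)) (at σ (d n))}} (v-nonNeg n σ) ⟩
    a * v n σ ∎
    where
    open ≤-Reasoning
    a = agree (at σ (c n)) (at σ (d n))

  v-[] : ∀ n → v n [] ≡ 2⁻^ n
  v-[] zero    = refl
  v-[] (suc n) = cong (½ *_) (v-[] n)

  agree-settled : ∀ σ b n → c n < length σ →
    agree (at (σ ∷ʳ b) (c n)) (at (σ ∷ʳ b) (d n)) ≡ agree (at σ (c n)) (at σ (d n))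
  agree-settled σ b n c<l =
    cong₂ agree (at-∷ʳ-< σ b c<l) (at-∷ʳ-< σ b (ℕ.<-trans (d<c n) c<l))

  v-settled : ∀ n σ b → c n ℕ.≤ length σ → v n (σ ∷ʳ b) ≡ v n σ
  v-settled zero    σ b _   = refl
  v-settled (suc n) σ b c≤l = cong₂ _*_ (agree-settled σ b n c<l) (v-settled n σ b (ℕ.<⇒≤ c<l))
    where
    c<l : c n < length σ
    c<l = ℕ.<-≤-trans (c-mono n) c≤l

  -- The next digit has position `length σ`. Before `c n` the new factor stays ½; at `c n` exactly
  -- one of the two digits agrees with the known partner and the earlier factors are settled; after
  -- `c n` nothing changes.
  v-martingale : ∀ n → Martingale (v n)
  v-martingale zero    σ = refl
  v-martingale (suc n) σ with ℕ.<-cmp (length σ) (c n)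
  ... | tri< l<c _ _ = begin
    ½ * (v (suc n) (σ ∷ʳ false) + v (suc n) (σ ∷ʳ true))
      ≡⟨ cong (½ *_) (cong₂ _+_ (undecided false) (undecided true)) ⟩
    ½ * (½ * v n (σ ∷ʳ false) + ½ * v n (σ ∷ʳ true))
      ≡⟨ solve 2 (λ x y → con ½ :* (con ½ :* x :+ con ½ :* y) := con ½ :* (con ½ :* (x :+ y))) refl
           (v n (σ ∷ʳ false)) (v n (σ ∷ʳ true)) ⟩
    ½ * (½ * (v n (σ ∷ʳ false) + v n (σ ∷ʳ true)))
      ≡⟨ cong (½ *_) (v-martingale n σ) ⟩
    ½ * v n σ
      ≡⟨ cong (λ x → agree x (at σ (d n)) * v n σ) (at-beyond σ (ℕ.<⇒≤ l<c)) ⟨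
    v (suc n) σ ∎
    where
    open ≡-Reasoning
    undecided : ∀ b → v (suc n) (σ ∷ʳ b) ≡ ½ * v n (σ ∷ʳ b)
    undecided b = cong (λ x → agree x (at (σ ∷ʳ b) (d n)) * v n (σ ∷ʳ b)) (at-∷ʳ-> σ b l<c)
  ... | tri≈ _ l≡c _ with e , at-d ← at-within σ (subst (d n <_) (sym l≡c) (d<c n)) = begin
    ½ * (v (suc n) (σ ∷ʳ false) + v (suc n) (σ ∷ʳ true))
      ≡⟨ cong (½ *_) (cong₂ _+_ (decided false) (decided true)) ⟩
    ½ * (agree (bit false) (bit e) * v n σ + agree (bit true) (bit e) * v n σ)
      ≡⟨ cong (½ *_) (*-distribʳ-+ (v n σ) (agree (bit false) (bit e)) (agree (bit true) (bit e))) ⟨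
    ½ * ((agree (bit false) (bit e) + agree (bit true) (bit e)) * v n σ)
      ≡⟨ cong (λ x → ½ * (x * v n σ)) (agree-total e) ⟩
    ½ * (1ℚ * v n σ)
      ≡⟨ cong (½ *_) (*-identityˡ (v n σ)) ⟩
    ½ * v n σ
      ≡⟨ cong (λ x → agree x (at σ (d n)) * v n σ) (at-beyond σ (ℕ.≤-reflexive l≡c)) ⟨
    v (suc n) σ ∎
    where
    open ≡-Reasoning
    decided : ∀ b → v (suc n) (σ ∷ʳ b) ≡ agree (bit b) (bit e) * v n σ
    decided b = cong₂ _*_
      (cong₂ agree
        (trans (cong (at (σ ∷ʳ b)) (sym l≡c)) (at-∷ʳ-length σ b))
        (trans (at-∷ʳ-< σ b (subst (d n <_) (sym l≡c) (d<c n))) at-d))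
      (v-settled n σ b (ℕ.≤-reflexive (sym l≡c)))
  ... | tri> _ _ c<l = trans
    (cong (½ *_) (cong₂ _+_ (unchanged false) (unchanged true)))
    (solve 1 (λ x → con ½ :* (x :+ x) := x) refl (v (suc n) σ))
    where
    unchanged : ∀ b → v (suc n) (σ ∷ʳ b) ≡ v (suc n) σ
    unchanged b = cong₂ _*_ (agree-settled σ b n c<l) (v-settled n σ b (ℕ.<⇒≤ c<l))

  -- The condition `at σ (c k) ≢ 0` excludes two unread digits, which are equal as numbers but
  -- contribute the factor ½.
  v-agreeing : ∀ n σ → (∀ k → k < n → at σ (c k) ≢ 0 × at σ (c k) ≡ at σ (d k)) → v n σ ≡ 1ℚ
  v-agreeing zero    σ _ = refl
  v-agreeing (suc n) σ ok
    with c≢0 , c≡d ← ok n ℕ.≤-refl =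
    cong₂ _*_ (trans (cong (agree (at σ (c n))) (sym c≡d)) (agree-refl _ c≢0))
      (v-agreeing n σ (λ k k<n → ok k (ℕ.m<n⇒m<1+n k<n)))

  agreement-small : ∀ {W : Pred Str 0ℓ} n →
    (∀ {σ} → W σ → ∀ k → k < n → at σ (c k) ≢ 0 × at σ (c k) ≡ at σ (d k)) →
    μ⟦ W ⟧≤ 2⁻^ n
  agreement-small {W} n W⇒ok = subst μ⟦ W ⟧≤_ (v-[] n)
    (ville (v n) (v-nonNeg n) (v-martingale n)
      (λ {σ} w → ≤-reflexive (sym (v-agreeing n σ (W⇒ok w)))))

-- Computable functions

⇓-deterministic : ∀ {n} {e : Rec n} {xs y z} → e [ xs ]⇓ y → e [ xs ]⇓ z → y ≡ z
⇓-deterministic-Vec : ∀ {m n} {gs : Vec (Rec n) m} {xs ys zs} →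
  Pointwise (λ g y → g [ xs ]⇓ y) gs ys → Pointwise (λ g y → g [ xs ]⇓ y) gs zs → ys ≡ zs

⇓-deterministic zer⇓ zer⇓ = refl
⇓-deterministic succ⇓ succ⇓ = refl
⇓-deterministic proj⇓ proj⇓ = refl
⇓-deterministic (comp⇓ ps p) (comp⇓ qs q) with refl ← ⇓-deterministic-Vec ps qs =
  ⇓-deterministic p q
⇓-deterministic (prec-zero p) (prec-zero q) = ⇓-deterministic p q
⇓-deterministic (prec-suc p p′) (prec-suc q q′) with refl ← ⇓-deterministic p q =
  ⇓-deterministic p′ q′
⇓-deterministic (mu⇓ {y = y} p ps) (mu⇓ {y = z} q qs) with ℕ.<-cmp y z
... | tri≈ _ y≡z _ = y≡z
-- At the smaller result one search finds 0 while the other records a successor.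
... | tri< y<z _ _ with _ , q′ ← qs y<z with () ← ⇓-deterministic p q′
... | tri> _ _ z<y with _ , p′ ← ps z<y with () ← ⇓-deterministic p′ q

⇓-deterministic-Vec []       []       = refl
⇓-deterministic-Vec (p ∷ ps) (q ∷ qs) =
  cong₂ _∷_ (⇓-deterministic p q) (⇓-deterministic-Vec ps qs)

-- Functions of a whole vector of variables let computability be proved along the syntax of an
-- expression, from `var`, `lift₁` and `lift₂`.
Computableⁿ : ∀ {n} → (Vec ℕ n → ℕ) → Set
Computableⁿ {n} F = Σ (Rec n) λ e → ∀ xs → e [ xs ]⇓ F xs

Computable₂ : (ℕ → ℕ → ℕ) → Set
Computable₂ f = Σ (Rec 2) λ e → ∀ x y → e [ x ∷ y ∷ [] ]⇓ f x y

private variable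
  n : ℕ
  F G : Vec ℕ n → ℕ
  f : ℕ → ℕ
  h : ℕ → ℕ → ℕ

var : (i : Fin n) → Computableⁿ (λ xs → lookup xs i)
var i = proj i , λ _ → proj⇓

lift₁ : Computable f → Computableⁿ F → Computableⁿ (λ xs → f (F xs))
lift₁ (e , e⇓) (a , a⇓) = comp e (a ∷ []) , λ xs → comp⇓ (a⇓ xs ∷ []) (e⇓ _)

lift₂ : Computable₂ h → Computableⁿ F → Computableⁿ G → Computableⁿ (λ xs → h (F xs) (G xs))
lift₂ (e , e⇓) (a , a⇓) (b , b⇓) =
  comp e (a ∷ b ∷ []) , λ xs → comp⇓ (a⇓ xs ∷ b⇓ xs ∷ []) (e⇓ _ _)

suc-computable : Computableⁿ F → Computableⁿ (λ xs → suc (F xs))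
suc-computable = lift₁ (succ , λ _ → succ⇓)

const-computable : ∀ k → Computableⁿ {n} (λ _ → k)
const-computable zero    = comp zer [] , λ _ → comp⇓ [] zer⇓
const-computable (suc k) = suc-computable (const-computable k)

computable : Computableⁿ {1} (λ xs → f (lookup xs zero)) → Computable f
computable (e , e⇓) = e , λ x → e⇓ (x ∷ [])

computable₂ : Computableⁿ {2} (λ xs → h (lookup xs zero) (lookup xs (suc zero))) → Computable₂ h
computable₂ (e , e⇓) = e , λ x y → e⇓ (x ∷ y ∷ [])

-- The recursion is only a provable equation, so the function may have been defined in another way,
-- as `⌊_/2⌋` is.
primrec₁ : ∀ {s : Vec ℕ 2 → ℕ} → Computableⁿ s →
  (∀ k → f (suc k) ≡ s (k ∷ f k ∷ [])) → Computable f
primrec₁ {f} (e , e⇓) step with z , z⇓ ← const-computable {0} (f 0) = prec z e , ⇓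
  where
  ⇓ : ∀ k → prec z e [ k ∷ [] ]⇓ f k
  ⇓ zero    = prec-zero (z⇓ [])
  ⇓ (suc k) = subst (prec z e [ suc k ∷ [] ]⇓_) (sym (step k)) (prec-suc (⇓ k) (e⇓ (k ∷ f k ∷ [])))

primrec₂ : ∀ {s : Vec ℕ 3 → ℕ} → Computable (h 0) → Computableⁿ s →
  (∀ k y → h (suc k) y ≡ s (k ∷ h k y ∷ y ∷ [])) → Computable₂ h
primrec₂ {h} (z , z⇓) (e , e⇓) step = prec z e , ⇓
  where
  ⇓ : ∀ k y → prec z e [ k ∷ y ∷ [] ]⇓ h k y
  ⇓ zero    y = prec-zero (z⇓ y)
  ⇓ (suc k) y = subst (prec z e [ suc k ∷ y ∷ [] ]⇓_) (sym (step k y))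
    (prec-suc (⇓ k y) (e⇓ (k ∷ h k y ∷ y ∷ [])))

pattern #0 = zero
pattern #1 = suc zero
pattern #2 = suc (suc zero)

+-computable : Computable₂ ℕ._+_
+-computable = primrec₂ (computable (var #0)) (suc-computable (var #1)) (λ _ _ → refl)

pred-computable : Computable pred
pred-computable = primrec₁ (var #0) (λ _ → refl)

∸-computable : Computable₂ _∸_
∸-computable = computable₂ (lift₂ flipped (var #1) (var #0))
  where
  -- Subtraction recurses on the subtrahend, and `prec` on its first argument.
  flipped : Computable₂ (λ y x → x ∸ y)
  flipped = primrec₂ (computable (var #0)) (lift₁ pred-computable (var #1)) (λ y x → sym (ℕ.pred[m∸n]≡m∸[1+n] x y))

ifZero : ℕ → ℕ → ℕ → ℕ
ifZero zero    y z = y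
ifZero (suc _) y z = z

ifZero-computable : ∀ {H : Vec ℕ n → ℕ} → Computableⁿ H → Computableⁿ F → Computableⁿ G →
                    Computableⁿ (λ xs → ifZero (H xs) (F xs) (G xs))
ifZero-computable {F = F} {G} {H} (e , e⇓) (a , a⇓) (b , b⇓) =
  -- The step function sees the predecessor, the previous value, and then both branches, so the
  -- second branch is its argument 3.
  comp (prec (proj #0) (proj (suc #2))) (e ∷ a ∷ b ∷ []) ,
  λ xs → comp⇓ (e⇓ xs ∷ a⇓ xs ∷ b⇓ xs ∷ []) (⇓ (H xs))
  where
  ⇓ : ∀ k {y z} → prec (proj #0) (proj (suc #2)) [ k ∷ y ∷ z ∷ [] ]⇓ ifZero k y z
  ⇓ zero    = prec-zero proj⇓
  ⇓ (suc k) = prec-suc (⇓ k) proj⇓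

-- Reading digits from the code of a string

parity : ℕ → ℕ
parity zero    = 0
parity (suc x) = 1 ∸ parity x

parity-computable : Computable parity
parity-computable =
  primrec₁ (lift₂ ∸-computable (const-computable 1) (var #1)) (λ _ → refl)

-- Here ⌊(k+1)/2⌋ = ⌈k/2⌉ = k ∸ ⌊k/2⌋, a recursion on the previous value alone.
half-computable : Computable ⌊_/2⌋
half-computable = primrec₁ (lift₂ ∸-computable (var #0) (var #1))
  (λ k → trans (sym (ℕ.m+n∸m≡n ⌊ k /2⌋ ⌈ k /2⌉)) (cong (_∸ ⌊ k /2⌋) (ℕ.⌊n/2⌋+⌈n/2⌉≡n k)))

parity-double : ∀ n → parity (n ℕ.+ n) ≡ 0
parity-double zero    = refl
parity-double (suc n) rewrite ℕ.+-suc n n | parity-double n = refl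

half-double : ∀ n → ⌊ n ℕ.+ n /2⌋ ≡ n
half-double n = sym (ℕ.n≡⌊n+n/2⌋ n)

half-suc-double : ∀ n → ⌊ suc (n ℕ.+ n) /2⌋ ≡ n
half-suc-double n = sym (ℕ.n≡⌈n+n/2⌉ n)

-- Inverts both `1 + 2c` and `2 + 2c`, and fixes 0, the code of the empty string.
tail : ℕ → ℕ
tail c = ⌊ pred c /2⌋

tail-computable : Computable tail
tail-computable = computable (lift₁ half-computable (lift₁ pred-computable (var #0)))

drop : ℕ → ℕ → ℕ
drop zero    c = c
drop (suc x) c = tail (drop x c)

drop-computable : Computable₂ drop
drop-computable = primrec₂ (computable (var #0)) (lift₁ tail-computable (var #1)) (λ _ _ → refl)

-- The least significant bijective base-2 digit, with 0 for the empty string as in `at`.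
head : ℕ → ℕ
head zero    = 0
head (suc c) = suc (parity c)

head-computable : Computable head
head-computable =
  primrec₁ (suc-computable (lift₁ parity-computable (var #0))) (λ _ → refl)

drop-0 : ∀ x → drop x 0 ≡ 0
drop-0 zero    = refl
drop-0 (suc x) = cong tail (drop-0 x)

drop-suc : ∀ x c → drop (suc x) c ≡ drop x (tail c)
drop-suc zero    c = refl
drop-suc (suc x) c = cong tail (drop-suc x c)

tail-code : ∀ b σ → tail (code (b ∷ σ)) ≡ code σ
tail-code false σ rewrite ℕ.+-identityʳ (code σ) = half-double (code σ)
tail-code true  σ rewrite ℕ.+-identityʳ (code σ) = half-suc-double (code σ)

head-code : ∀ b σ → head (code (b ∷ σ)) ≡ bit b
head-code false σ rewrite ℕ.+-identityʳ (code σ) | parity-double (code σ) = refl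
head-code true  σ rewrite ℕ.+-identityʳ (code σ) | parity-double (code σ) = refl

-- This makes `at σ x` computable from `code σ`, the form in which a test receives a string.
head-drop-code : ∀ σ x → head (drop x (code σ)) ≡ at σ x
head-drop-code []      x       = cong head (drop-0 x)
head-drop-code (b ∷ σ) zero    = head-code b σ
head-drop-code (b ∷ σ) (suc x) = begin
  head (drop (suc x) (code (b ∷ σ)))    ≡⟨ cong head (drop-suc x (code (b ∷ σ))) ⟩
  head (drop x (tail (code (b ∷ σ))))   ≡⟨ cong (head ∘ drop x) (tail-code b σ) ⟩
  head (drop x (code σ))                ≡⟨ head-drop-code σ x ⟩
  at σ x                                ∎
  where open ≡-Reasoning

-- A total predicate is the domain of an unbounded search whose body
-- ignores the search variable.
decidable⇒uniformlyCE : Computable₂ h → UniformlyCE (λ n σ → h n (code σ) ≡ 0)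
decidable⇒uniformlyCE {h} hᶜ
  with e , e⇓ ← lift₂ hᶜ (var {3} #1) (var #2) =
  mu e , λ n σ → mk⇔
    (λ eq → 0 , mu⇓ (subst (e [ 0 ∷ n ∷ code σ ∷ [] ]⇓_) eq (e⇓ (0 ∷ n ∷ code σ ∷ []))) (λ ()))
    (λ { (y , mu⇓ p _) → ⇓-deterministic (e⇓ (y ∷ n ∷ code σ ∷ [])) p })

-- Random sets and the antichain

private variable
  A : Cantor

-- Turns equality of numbers into the vanishing of a computable function.
dist : ℕ → ℕ → ℕ
dist x y = (x ∸ y) ℕ.+ (y ∸ x)

dist-refl : ∀ x → dist x x ≡ 0
dist-refl x rewrite ℕ.n∸n≡0 x = refl

dist≡0⇒≡ : ∀ x y → dist x y ≡ 0 → x ≡ y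
dist≡0⇒≡ x y eq = ℕ.≤-antisym (ℕ.m∸n≡0⇒m≤n (ℕ.m+n≡0⇒m≡0 (x ∸ y) eq))
                              (ℕ.m∸n≡0⇒m≤n (ℕ.m+n≡0⇒n≡0 (x ∸ y) eq))

dist-computable : Computable₂ dist
dist-computable = computable₂ (lift₂ +-computable (lift₂ ∸-computable (var #0) (var #1))
                                                  (lift₂ ∸-computable (var #1) (var #0)))

⊓<⊔ : ∀ {m n} → m ≢ n → m ⊓ n < m ⊔ n
⊓<⊔ {m} {n} m≢n with ℕ.<-cmp m n
... | tri< m<n _ _ = subst₂ _<_ (sym (ℕ.m≤n⇒m⊓n≡m (ℕ.<⇒≤ m<n))) (sym (ℕ.m≤n⇒m⊔n≡n (ℕ.<⇒≤ m<n))) m<n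
... | tri≈ _ m≡n _ = contradiction m≡n m≢n
... | tri> _ _ n<m = subst₂ _<_ (sym (ℕ.m≥n⇒m⊓n≡n (ℕ.<⇒≤ n<m))) (sym (ℕ.m≥n⇒m⊔n≡m (ℕ.<⇒≤ n<m))) n<m

at-applyUpTo : ∀ (X : Cantor) {n x} → x < n → at (applyUpTo X n) x ≡ bit (X x)
at-applyUpTo X {suc n} {zero}  _         = refl
at-applyUpTo X {suc n} {suc x} (s≤s x<n) = at-applyUpTo (X ∘ suc) x<n

bit≢0 : ∀ b → bit b ≢ 0
bit≢0 false ()
bit≢0 true  ()

module _ {a b : ℕ → ℕ} (aᶜ : Computable a) (bᶜ : Computable b) (a≢b : ∀ k → a k ≢ b k)
         (increasing : ∀ k → a k ⊔ b k < a (suc k) ⊔ b (suc k)) where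

  -- Vanishes exactly when both positions lie within the string coded by s
  -- and carry the same bit.
  violation : ℕ → ℕ → ℕ
  violation k s = (1 ∸ head (drop (a k) s)) ℕ.+ dist (head (drop (a k) s)) (head (drop (b k) s))

  violations : ℕ → ℕ → ℕ
  violations zero    s = 0
  violations (suc n) s = violation n s ℕ.+ violations n s

  violations-computable : Computable₂ violations
  violations-computable = primrec₂ (computable (const-computable 0))
    (lift₂ +-computable
      (lift₂ +-computable (lift₂ ∸-computable (const-computable 1) (digit aᶜ))
                          (lift₂ dist-computable (digit aᶜ) (digit bᶜ)))
      (var #1))
    (λ _ _ → refl)
    where
    digit : ∀ {f} → Computable f → Computableⁿ {3} (λ xs → head (drop (f (lookup xs #0)) (lookup xs #2)))
    digit fᶜ = lift₁ head-computable (lift₂ drop-computable (lift₁ fᶜ (var #0)) (var #2))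

  violation≡0⇒agree : ∀ k σ → violation k (code σ) ≡ 0 →
    at σ (a k ⊔ b k) ≢ 0 × at σ (a k ⊔ b k) ≡ at σ (a k ⊓ b k)
  violation≡0⇒agree k σ eq
    rewrite head-drop-code σ (a k) | head-drop-code σ (b k)
    with at-a≢0 ← (λ at-a≡0 → ℕ.1+n≢0 (trans (sym (cong (1 ∸_) at-a≡0)) (ℕ.m+n≡0⇒m≡0 (1 ∸ at σ (a k)) eq)))
    with at-a≡at-b ← dist≡0⇒≡ (at σ (a k)) (at σ (b k)) (ℕ.m+n≡0⇒n≡0 (1 ∸ at σ (a k)) eq)
    with ℕ.≤-total (a k) (b k)
  ... | inj₁ a≤b rewrite ℕ.m≤n⇒m⊔n≡n a≤b | ℕ.m≤n⇒m⊓n≡m a≤b =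
    (λ at-b≡0 → at-a≢0 (trans at-a≡at-b at-b≡0)) , sym at-a≡at-b
  ... | inj₂ b≤a rewrite ℕ.m≥n⇒m⊔n≡m b≤a | ℕ.m≥n⇒m⊓n≡n b≤a = at-a≢0 , at-a≡at-b

  violations≡0⇒agree : ∀ n σ → violations n (code σ) ≡ 0 → ∀ k → k < n →
    at σ (a k ⊔ b k) ≢ 0 × at σ (a k ⊔ b k) ≡ at σ (a k ⊓ b k)
  violations≡0⇒agree (suc n) σ eq k k<1+n with ℕ.m<1+n⇒m<n∨m≡n k<1+n
  ... | inj₁ k<n  = violations≡0⇒agree n σ (ℕ.m+n≡0⇒n≡0 (violation n (code σ)) eq) k k<n
  ... | inj₂ refl = violation≡0⇒agree k σ (ℕ.m+n≡0⇒m≡0 (violation n (code σ)) eq)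

  agreementTest : MLTest
  agreementTest = record
    { W     = λ n σ → violations n (code σ) ≡ 0
    ; ce    = decidable⇒uniformlyCE violations-computable
    -- The larger position of each pair serves as `c`, the smaller as `d`.
    ; small = λ n → agreement-small (λ k → ⊓<⊔ (a≢b k)) increasing n
                      (λ {σ} → violations≡0⇒agree n σ)
    }

  violations-applyUpTo : ∀ {X L} → (∀ k → X (a k) ≡ X (b k)) → ∀ n → (∀ k → k < n → a k ⊔ b k < L) →
    violations n (code (applyUpTo X L)) ≡ 0
  violations-applyUpTo Xa≡Xb zero bound = refl
  violations-applyUpTo {X} {L} Xa≡Xb (suc n) bound
    rewrite head-drop-code (applyUpTo X L) (a n) | head-drop-code (applyUpTo X L) (b n)
          | at-applyUpTo X (ℕ.m⊔n<o⇒m<o (a n) (b n) (bound n ℕ.≤-refl))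
          | at-applyUpTo X (ℕ.m⊔n<o⇒n<o (a n) (b n) (bound n ℕ.≤-refl))
          | Xa≡Xb n | dist-refl (bit (X (b n)))
    with X (b n)
  ... | false = violations-applyUpTo Xa≡Xb n (λ k k<n → bound k (ℕ.m<n⇒m<1+n k<n))
  ... | true  = violations-applyUpTo Xa≡Xb n (λ k k<n → bound k (ℕ.m<n⇒m<1+n k<n))

  max-mono : ∀ {k n} → k < n → a k ⊔ b k < a n ⊔ b n
  max-mono {k} {suc n} k<1+n with ℕ.m<1+n⇒m<n∨m≡n k<1+n
  ... | inj₁ k<n  = ℕ.<-trans (max-mono k<n) (increasing n)
  ... | inj₂ refl = increasing n

  random⇒disagree-increasing : MLRandom A → ¬ (∀ k → A (a k) ≡ A (b k))
  random⇒disagree-increasing {A} random Aa≡Ab = random agreementTest λ n →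
    -- Level `n` inspects only the pairs `k < n`, whose positions lie below the maximum of pair `n`.
    let L = a n ⊔ b n in
    applyUpTo A L , violations-applyUpTo Aa≡Ab n (λ k → max-mono) ,
    cong (applyUpTo A) (length-applyUpTo A L)

module _ {q w : ℕ → ℕ} (qᶜ : Computable q) (wᶜ : Computable w)
         (q≢w : ∀ n → q n ≢ w n) (n≤q : ∀ n → n ℕ.≤ q n) where

  -- A subsequence along which every edge {q n , w n} contains a vertex
  -- larger than all earlier ones.
  fresh : ℕ → ℕ
  fresh zero    = 0
  fresh (suc k) = suc (q (fresh k) ℕ.+ w (fresh k))

  fresh-computable : Computable fresh
  fresh-computable = primrec₁
    (suc-computable (lift₂ +-computable (lift₁ qᶜ (var #1)) (lift₁ wᶜ (var #1)))) (λ _ → refl)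

  random⇒disagree : MLRandom A → ¬ (∀ n → A (q n) ≡ A (w n))
  random⇒disagree random Aq≡Aw =
    random⇒disagree-increasing (subsequence qᶜ) (subsequence wᶜ) (q≢w ∘ fresh) increasing
      random (Aq≡Aw ∘ fresh)
    where
    subsequence : ∀ {f} → Computable f → Computable (f ∘ fresh)
    subsequence fᶜ = computable (lift₁ fᶜ (lift₁ fresh-computable (var #0)))

    increasing : ∀ k → q (fresh k) ⊔ w (fresh k) < q (fresh (suc k)) ⊔ w (fresh (suc k))
    increasing k = begin-strict
      q (fresh k) ⊔ w (fresh k)                ≤⟨ ℕ.m⊔n≤m+n (q (fresh k)) (w (fresh k)) ⟩
      q (fresh k) ℕ.+ w (fresh k)              <⟨ ℕ.n<1+n _ ⟩
      fresh (suc k)                            ≤⟨ n≤q (fresh (suc k)) ⟩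
      q (fresh (suc k))                        ≤⟨ ℕ.m≤m⊔n _ _ ⟩
      q (fresh (suc k)) ⊔ w (fresh (suc k))    ∎
      where open ℕ.≤-Reasoning

-- Column i is the residue class of 2^i - 1 modulo 2^(i+1).
column : ℕ → ℕ → ℕ
column zero    k = k ℕ.+ k
column (suc i) k = suc (column i k ℕ.+ column i k)

double-injective : ∀ m n → m ℕ.+ m ≡ n ℕ.+ n → m ≡ n
double-injective m n eq = trans (sym (half-double m)) (trans (cong ⌊_/2⌋ eq) (half-double n))

double≢suc-double : ∀ m n → m ℕ.+ m ≢ suc (n ℕ.+ n)
double≢suc-double m n eq = ℕ.0≢1+n (begin
  0                      ≡⟨ parity-double m ⟨
  parity (m ℕ.+ m)       ≡⟨ cong parity eq ⟩
  1 ∸ parity (n ℕ.+ n)   ≡⟨ cong (1 ∸_) (parity-double n) ⟩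
  1                      ∎)
  where open ≡-Reasoning

-- Since `column i k + 1` is 2^i (2k + 1), parity decides whether `i` is 0, and halving lowers `i`.
-- Thus `column` is also a pairing function.
column-injective : ∀ i j {k l} → column i k ≡ column j l → i ≡ j × k ≡ l
column-injective zero    zero    {k} {l} eq = refl , double-injective k l eq
column-injective zero    (suc j) {k} {l} eq = contradiction eq (double≢suc-double k (column j l))
column-injective (suc i) zero    {k} {l} eq = contradiction (sym eq) (double≢suc-double l (column i k))
column-injective (suc i) (suc j) {k} {l} eq
  with refl , refl ← column-injective i j (double-injective (column i k) (column j l) (ℕ.suc-injective eq)) =
  refl , refl

n≤column : ∀ i n → n ℕ.≤ column i n
n≤column zero    n = ℕ.m≤m+n n n
n≤column (suc i) n = ℕ.≤-trans (n≤column i n) (ℕ.m≤n⇒m≤1+n (ℕ.m≤m+n _ _))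

double-computable : ∀ {n} {F : Vec ℕ n → ℕ} → Computableⁿ F → Computableⁿ (λ xs → F xs ℕ.+ F xs)
double-computable Fᶜ = lift₂ +-computable Fᶜ Fᶜ

column-computable : ∀ i → Computable (column i)
column-computable zero    = computable (double-computable (var #0))
column-computable (suc i) =
  computable (suc-computable (double-computable (lift₁ (column-computable i) (var #0))))

-- Every value is attained at an even argument; the values in column i are
-- attained once more, at an odd argument.
cover : ℕ → ℕ → ℕ
cover i x = ifZero (parity x) ⌊ x /2⌋ (column i ⌊ x /2⌋)

cover-computable : ∀ i → Computable (cover i)
cover-computable i = computable (ifZero-computable (lift₁ parity-computable (var #0)) half
  (lift₁ (column-computable i) half))
  where
  half : Computableⁿ {1} (λ xs → ⌊ lookup xs #0 /2⌋)
  half = lift₁ half-computable (var #0)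

cover-double : ∀ i n → cover i (n ℕ.+ n) ≡ n
cover-double i n rewrite parity-double n = half-double n

cover-suc-double : ∀ i n → cover i (suc (n ℕ.+ n)) ≡ column i n
cover-suc-double i n rewrite parity-double n = cong (column i) (half-suc-double n)

even⊎odd : ∀ x → (∃[ n ] x ≡ n ℕ.+ n) ⊎ (∃[ n ] x ≡ suc (n ℕ.+ n))
even⊎odd zero = inj₁ (0 , refl)
even⊎odd (suc x) with even⊎odd x
... | inj₁ (n , refl) = inj₂ (n , refl)
... | inj₂ (n , refl) = inj₁ (suc n , cong suc (sym (ℕ.+-suc n n)))

-- An odd argument of `cover j` has its value in column `j`, which is disjoint from column `i`.
cover-fibre : ∀ {i j} → i ≢ j → ∀ {n} y → cover j y ≡ column i n → y ≡ column i n ℕ.+ column i n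
cover-fibre {i} {j} i≢j {n} y eq with even⊎odd y
... | inj₁ (k , refl) = cong (λ x → x ℕ.+ x) (trans (sym (cover-double j k)) eq)
... | inj₂ (k , refl) = contradiction
  (proj₁ (column-injective i j (trans (sym eq) (cover-suc-double j k)))) i≢j

T⇔⇒≡ : ∀ x y → T x ⇔ T y → x ≡ y
T⇔⇒≡ false false _ = refl
T⇔⇒≡ true  true  _ = refl
T⇔⇒≡ true  false e with () ← Equivalence.to e tt
T⇔⇒≡ false true  e with () ← Equivalence.from e tt

module _ (random : MLRandom A) {i j : ℕ} (i≢j : i ≢ j) {f : ℕ → ℕ} (fᶜ : Computable f)
         (f-injective : Injective _≡_ _≡_ f) (reduces : Reduces f (A ∘ cover i) (A ∘ cover j)) where

  image : ℕ → ℕ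
  image x = cover j (f x)

  image-computable : ∀ {n} {F : Vec ℕ n → ℕ} → Computableⁿ F → Computableⁿ (λ xs → image (F xs))
  image-computable Fᶜ = lift₁ (cover-computable j) (lift₁ fᶜ Fᶜ)

  A-image : ∀ x → A (cover i x) ≡ A (image x)
  A-image x = T⇔⇒≡ _ _ (reduces x)

  -- The two elements of the fibre of cover i over column i n cannot both
  -- be mapped by f into the one-element fibre of cover j over it.
  partner : ℕ → ℕ
  partner n = ifZero (dist (image (q ℕ.+ q)) q) (image (suc (n ℕ.+ n))) (image (q ℕ.+ q))
    where q = column i n

  partner-computable : Computable partner
  partner-computable = computable (ifZero-computable
    (lift₂ dist-computable first q) (image-computable (suc-computable (double-computable (var #0)))) first)
    where
    q : Computableⁿ {1} (λ xs → column i (lookup xs #0))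
    q = lift₁ (column-computable i) (var #0)
    first = image-computable (double-computable q)

  column≢partner : ∀ n → column i n ≢ partner n
  column≢partner n eq with dist (image (column i n ℕ.+ column i n)) (column i n) in d
  -- Both values of `f` would be the single element of the fibre, so `f` would identify an even and
  -- an odd argument.
  ... | zero  = double≢suc-double (column i n) n (f-injective (trans
    (cover-fibre i≢j (f (column i n ℕ.+ column i n)) (dist≡0⇒≡ _ _ d))
    (sym (cover-fibre i≢j (f (suc (n ℕ.+ n))) (sym eq)))))
  ... | suc _ = ℕ.0≢1+n (trans (sym (trans (cong (λ y → dist y (column i n)) (sym eq)) (dist-refl (column i n)))) d)

  A-partner : ∀ n → A (column i n) ≡ A (partner n)
  A-partner n with dist (image (column i n ℕ.+ column i n)) (column i n)
  ... | zero  = trans (cong A (sym (cover-suc-double i n))) (A-image (suc (n ℕ.+ n)))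
  ... | suc _ = trans (cong A (sym (cover-double i (column i n)))) (A-image (column i n ℕ.+ column i n))

  cover-irreducible : Empty.⊥
  cover-irreducible = random⇒disagree (column-computable i) partner-computable column≢partner
    (n≤column i) random A-partner

random⇒antichain : ∀ A → MLRandom A → HasInfiniteAntichain A
random⇒antichain A random = (λ i → A ∘ cover i) , inDegree ,
  λ i j i≢j (f , fᶜ , f-injective , reduces) → cover-irreducible random i≢j fᶜ f-injective reduces
  where
  inDegree : ∀ i → A ∘ cover i ≡ₘ A
  inDegree i =
    (cover i , cover-computable i , λ x → ⇔-refl) ,
    -- Doubling is a right inverse of `cover i`.
    ((λ x → x ℕ.+ x) , computable (double-computable (var #0)) ,
     λ x → subst (λ y → T (A x) ⇔ T (A y)) (sym (cover-double i x)) ⇔-refl)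

-- An injective numbering of the codes

index : ∀ {n} → Rec n → ℕ
indices : ∀ {m n} → Vec (Rec n) m → ℕ
tag body : ∀ {n} → Rec n → ℕ

index e = column (tag e) (body e)

-- A nonempty vector may also receive 0; only vectors of equal length are compared.
indices []       = 0
indices (e ∷ es) = column (index e) (indices es)

tag zer        = 0
tag succ       = 1
tag (proj _)   = 2
tag (comp _ _) = 3
tag (prec _ _) = 4
tag (mu _)     = 5

body zer                = 0
body succ               = 0
body (proj i)           = toℕ i
-- The intermediate arity `m` is not visible in the type of the code, so it is recorded, and
-- recovered before the components are compared.
body (comp {m = m} e es) = column m (column (index e) (indices es))
body (prec e e′)        = column (index e) (index e′)
body (mu e)             = index e

index-injective : ∀ {n} (d e : Rec n) → index d ≡ index e → d ≡ e
indices-injective : ∀ {m n} (ds es : Vec (Rec n) m) → indices ds ≡ indices es → ds ≡ es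
body-injective : ∀ {n} (d e : Rec n) → tag d ≡ tag e → body d ≡ body e → d ≡ e

index-injective d e eq with t , b ← column-injective (tag d) (tag e) eq = body-injective d e t b

indices-injective []       []       _  = refl
indices-injective (d ∷ ds) (e ∷ es) eq
  with h , t ← column-injective (index d) (index e) eq =
  cong₂ _∷_ (index-injective d e h) (indices-injective ds es t)

body-injective zer         zer         _ _  = refl
body-injective succ        succ        _ _  = refl
body-injective (proj i)    (proj j)    _ eq = cong proj (toℕ-injective eq)
body-injective (comp {m = m} d ds) (comp {m = m′} e es) _ eq
  with refl , eq′ ← column-injective m m′ eq
  with h , t ← column-injective (index d) (index e) eq′ =
  cong₂ comp (index-injective d e h) (indices-injective ds es t)
body-injective (prec d d′) (prec e e′) _ eq
  with h , t ← column-injective (index d) (index e) eq =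
  cong₂ prec (index-injective d e h) (index-injective d′ e′ t)
body-injective (mu d)      (mu e)      _ eq = cong mu (index-injective d e eq)

-- Almost every set is random

domain : Rec 2 → ℕ → Pred Str 0ℓ
domain e n σ = Halts e (n ∷ code σ ∷ [])

IsTest : Rec 2 → Set
IsTest e = ∀ n → μ⟦ domain e n ⟧≤ 2⁻^ n

-- Codes in place of `MLTest` keep the predicate in `Set` and make the tests countable.
NonRandom : Pred Cantor 0ℓ
NonRandom X = Σ (Rec 2) λ e → IsTest e × (∀ n → X ∈ ⟦ domain e n ⟧)

-- The test with index `c` contributes its level `c + n + 1`; these bounds sum to `2⁻^ n`.
NonRandom-null : Null NonRandom
NonRandom-null n = (λ σ → ∃[ c ] V c σ) , covered , countable-union n V-small
  where
  V : ℕ → Pred Str 0ℓ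
  -- With `IsTest e` inside, `V c` is empty when `c` is not the index of a test, and no case
  -- distinction is made.
  V c σ = Σ (Rec 2) λ e → index e ≡ c × IsTest e × domain e (suc (c ℕ.+ n)) σ

  covered : NonRandom ⊆ ⟦ (λ σ → ∃[ c ] V c σ) ⟧
  covered (e , test , X∈) with σ , σ∈ , X∈σ ← X∈ (suc (index e ℕ.+ n)) =
    σ , (index e , e , refl , test , σ∈) , X∈σ

  V-small : ∀ c → μ⟦ V c ⟧≤ 2⁻^ (suc (c ℕ.+ n))
  V-small c [] ws ds = 2⁻^-nonNeg (suc (c ℕ.+ n))
  -- The first string of a nonempty family supplies a test, and by injectivity of `index` the others
  -- come from the same one.
  V-small c σs@(_ ∷ _) ws@((e , e≡c , test , _) ∷ _) ds = test (suc (c ℕ.+ n)) σs (All.map (λ {σ} → same {σ}) ws) ds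
    where
    same : ∀ {σ} → V c σ → domain e (suc (c ℕ.+ n)) σ
    same (d , d≡c , _ , σ∈) with refl ← index-injective d e (trans d≡c (sym e≡c)) = σ∈

∉NonRandom⇒MLRandom : ∀ A → ¬ NonRandom A → MLRandom A
∉NonRandom⇒MLRandom A A∉ record { W = W ; ce = e , W⇔ ; small = small } A∈ = A∉ (e ,
  (λ n σs ws ds → small n σs (All.map (λ {σ} → Equivalence.from (W⇔ n σ)) ws) ds) ,
  λ n → let σ , σ∈ , A∈σ = A∈ n in σ , Equivalence.to (W⇔ n σ) σ∈ , A∈σ)

corollary4p2 : AlmostEvery HasInfiniteAntichain × (∀ A → MLRandom A → HasInfiniteAntichain A)
corollary4p2 =
  (NonRandom , NonRandom-null , λ A A∉ → random⇒antichain A (∉NonRandom⇒MLRandom A A∉)) ,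
  random⇒antichain
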